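{- Every Hamiltonian $\{4\text{ -fan}, \overline{A}\}$-free chordal graph is cycle extendable.
   Context: All graphs are finite, undirected, and simple. A graph is Hamiltonian if it has a cycle through all its vertices. A graph is chordal if it has no induced cycle of length at least $4$. The $4$-fan is the graph on $6$ vertices obtained from a path on $5$ vertices by adding one vertex adjacent to all vertices of the path. The graph $\overline{A}$ is the graph on six vertices $p', p, z, z', q, q'$ with exactly the nine edges $p'p,\ p'z,\ pz,\ pz',\ zz',\ qz,\ qz',\ q'q,\ q'z'$ (equivalently, the complement of the graph $A$ obtained from a cycle on $4$ vertices by attaching one pendant vertex to each of two adjacent vertices of the cycle). A graph is $\{4\text{ -fan},\overline{A}\}$-free if it has no induced subgraph isomorphic to the $4$-fan or to $\overline{A}$. A cycle $C$ in a graph is extendable if there exists a cycle $C'$ whose vertex set consists of all vertices of $C$ plus exactly one more vertex not in $C$. A graph is cycle extendable if all its non-Hamiltonian cycles are extendable. -}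

module Defs where

open import Data.Fin using (Fin; toℕ; _≟_)
open import Data.Fin.Patterns using (0F; 1F; 2F; 3F; 4F; 5F)
open import Data.List using (List; []; _∷_)
open import Data.List.Membership.Propositional using (_∈_)
open import Data.Nat using (ℕ; suc; _≤_)
open import Data.Product using (_×_; _,_; ∃-syntax)
open import Data.Product.Properties using (≡-dec)
open import Data.Sum using (_⊎_; swap)
open import Function.Bundles using (_⇔_)
open import Function.Definitions using (Injective)
open import Level using (0ℓ)
open import Relation.Binary.Core using (Rel)
open import Relation.Binary.Definitions using (Symmetric; Irreflexive; Decidable)
open import Relation.Binary.PropositionalEquality using (_≡_; _≢_; ≢-sym)
open import Relation.Nullary using (¬_)
open import Relation.Nullary.Decidable using (_×-dec_; _⊎-dec_; ¬?)
import Data.List.Membership.DecPropositional as DecMembership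

-- Adjacency is required to be decidable so that finite graphs behave as
-- they do classically.
record Graph (n : ℕ) : Set₁ where
  field
    Adj    : Rel (Fin n) 0ℓ
    sym    : Symmetric Adj
    irrefl : Irreflexive _≡_ Adj
    adj?   : Decidable Adj

open Graph public using (Adj)

-- Each edge is listed once, in either orientation; loops are discarded.
fromEdges : ∀ {n} → List (Fin n × Fin n) → Graph n
fromEdges {n} es = record
  { Adj    = λ u v → u ≢ v × ((u , v) ∈ es ⊎ (v , u) ∈ es)
  ; sym    = λ (u≢v , e) → ≢-sym u≢v , swap e
  ; irrefl = λ u≡v (u≢v , _) → u≢v u≡v
  ; adj?   = λ u v → ¬? (u ≟ v) ×-dec (((u , v) ∈? es) ⊎-dec ((v , u) ∈? es))
  }
  where open DecMembership (≡-dec (_≟_ {n}) (_≟_ {n})) using (_∈?_)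

-- The path is 0 – 1 – 2 – 3 – 4 and the universal vertex is 5.
4-fan : Graph 6
4-fan = fromEdges
  ( (0F , 1F) ∷ (1F , 2F) ∷ (2F , 3F) ∷ (3F , 4F)
  ∷ (5F , 0F) ∷ (5F , 1F) ∷ (5F , 2F) ∷ (5F , 3F) ∷ (5F , 4F) ∷ [] )

Ā : Graph 6
Ā = fromEdges
  ( (p′ , p) ∷ (p′ , z) ∷ (p , z) ∷ (p , z′) ∷ (z , z′)
  ∷ (q , z) ∷ (q , z′) ∷ (q′ , q) ∷ (q′ , z′) ∷ [] )
  where
  p′ p z z′ q q′ : Fin 6
  p′ = 0F
  p  = 1F
  z  = 2F
  z′ = 3F
  q  = 4F
  q′ = 5F

record InducedCopy {m n} (H : Graph m) (G : Graph n) : Set where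
  field
    embed     : Fin m → Fin n
    injective : Injective _≡_ _≡_ embed
    induced   : ∀ i j → Adj H i j ⇔ Adj G (embed i) (embed j)

_-free : ∀ {m n} → Graph m → Graph n → Set
(H -free) G = ¬ InducedCopy H G

-- j is the successor of i in the cyclic order 0, 1, …, k-1, 0.
Next : ∀ {k} → Fin k → Fin k → Set
Next {k} i j = toℕ j ≡ suc (toℕ i) ⊎ (suc (toℕ i) ≡ k × toℕ j ≡ 0)

-- A cycle, presented by listing its distinct vertices in cyclic order.
record Cycle {n} (G : Graph n) : Set where
  field
    length    : ℕ
    length≥3  : 3 ≤ length
    vertex    : Fin length → Fin n
    injective : Injective _≡_ _≡_ vertex
    adjacent  : ∀ i j → Next i j → Adj G (vertex i) (vertex j)

module _ {n} {G : Graph n} where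

  open Cycle

  _∈ᶜ_ : Fin n → Cycle G → Set
  v ∈ᶜ C = ∃[ i ] vertex C i ≡ v

  IsInduced : Cycle G → Set
  IsInduced C = ∀ i j → Adj G (vertex C i) (vertex C j) → Next i j ⊎ Next j i

  IsHamiltonian : Cycle G → Set
  IsHamiltonian C = ∀ v → v ∈ᶜ C

  Extendable : Cycle G → Set
  Extendable C =
    ∃[ C′ ] ∃[ v ] ¬ (v ∈ᶜ C) × (∀ u → u ∈ᶜ C′ ⇔ (u ∈ᶜ C ⊎ u ≡ v))

Hamiltonian : ∀ {n} → Graph n → Set
Hamiltonian G = ∃[ C ] IsHamiltonian {G = G} C

Chordal : ∀ {n} → Graph n → Set
Chordal G = (C : Cycle G) → 4 ≤ Cycle.length C → ¬ IsInduced C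

CycleExtendable : ∀ {n} → Graph n → Set
CycleExtendable G = (C : Cycle G) → ¬ IsHamiltonian C → Extendable C

{-# OPTIONS --safe #-}
module Submission where

-- Let C be a cycle inside a larger cycle Z, initially Hamiltonian, and let W be the
-- vertex set of Z. A vertex of W ∖ C that is simplicial in G[W] can be deleted from
-- Z, its neighbours on Z being adjacent; if it is the only vertex of W ∖ C, then Z
-- itself extends C. So it suffices to find such a vertex. Suppose h ∈ W ∖ C has
-- nonadjacent neighbours x and y. Let B be the component of y in G[W] − N[x], let
-- S = N(B), a clique containing h, and let A be the component of x in G[W] − S.
-- If a pair s, t ∈ S is told apart by a vertex of A and by a vertex of B, then
-- chordality gives adjacent p, p′ ∈ A with p adjacent to both of s, t and p′ to
-- exactly one, likewise q, q′ ∈ B, and these six vertices induce a 4-fan or Ā.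
-- Hence the vertices of one of A, B, say A, see all or nothing of S. If C leaves A
-- along an edge as with s ∈ S, then h is adjacent to a and s and can be inserted.
-- Otherwise C misses A or B, and by Dirac's argument that side contains a vertex
-- simplicial in G[W].

open import Defs
open import Data.Bool using (Bool; true; false)
open import Data.Empty using (⊥; ⊥-elim)
open import Data.Fin using (Fin; zero; suc; toℕ; fromℕ; inject₁; _≟_)
open import Data.Fin.Patterns using (0F; 1F; 2F; 3F; 4F)
open import Data.Fin.Properties using (any?; injective⇒≤; toℕ-inject₁; toℕ-fromℕ; <-cmp)
open import Data.Fin.Subset using (Subset; _∈_; _∉_; _⊆_; _⊂_; _⊃_; _∪_; ⁅_⁆)
open import Data.Fin.Subset.Induction using (⊂-wellFounded; ⊃-wellFounded)
open import Data.Fin.Subset.Properties using (_∈?_; x∈p∪q⁺; x∈p∪q⁻; x∈⁅x⁆; x∈⁅y⁆⇒x≡y)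
open import Data.List using (List; []; _∷_; [_]; _++_; length; lookup; tabulate; initLast; _∷ʳ′_)
open import Data.List.Properties using (++-assoc; ++-identityʳ; length-tabulate)
open import Data.List.Membership.Propositional using (find) renaming (_∈_ to _∈ₗ_; _∉_ to _∉ₗ_)
open import Data.List.Membership.Propositional.Properties
  using (∈-∃++; ∈-insert; ∈-lookup; ∈-tabulate⁺; ∈-tabulate⁻)
import Data.List.Membership.DecPropositional as DecMembership
open import Data.List.Membership.Setoid.Properties using (index-injective)
open import Data.List.Relation.Binary.Permutation.Propositional
  using (_↭_; ↭⇒↭ₛ; ↭-sym; ↭-trans; ↭-reflexive)
open import Data.List.Relation.Binary.Permutation.Propositional.Properties
  using (++-comm; ∈-resp-↭; All-resp-↭; ↭-length)
import Data.List.Relation.Binary.Permutation.Setoid.Properties as Permutation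
open import Data.List.Relation.Unary.All as All using (All; []; _∷_)
open import Data.List.Relation.Unary.All.Properties using (¬Any⇒All¬)
open import Data.List.Relation.Unary.AllPairs using ([]; _∷_)
open import Data.List.Relation.Unary.Any as Any using (here; there; index)
open import Data.List.Relation.Unary.Any.Properties using (lookup-index)
open import Data.List.Relation.Unary.Linked using (Linked; []; [-]; _∷_)
open import Data.List.Relation.Unary.Unique.Propositional using (Unique)
open import Data.List.Relation.Unary.Unique.Propositional.Properties
  using (tabulate⁺; Unique[x∷xs]⇒x∉xs)
open import Data.Nat using (ℕ; zero; suc; _+_; _≤_; _<_; z≤n; s≤s)
open import Data.Nat.Induction using (<-wellFounded)
open import Data.Nat.Properties using (≤-trans; suc-injective; ≤-reflexive)
open import Data.Product using (_×_; _,_; proj₁; proj₂; ∃-syntax)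
open import Data.Sum using (_⊎_; inj₁; inj₂; [_,_]′; swap; map₁)
open import Data.Unit using (⊤; tt)
open import Data.Vec as Vec using ([]; _∷_)
open import Data.Vec.Properties using (lookup∘tabulate; lookup⇒[]=; []=⇒lookup)
open import Function using (_∘_; _⇔_; mk⇔)
open import Function.Bundles using (Equivalence)
open import Induction.WellFounded using (Acc; acc)
open import Level using (0ℓ)
open import Relation.Binary.Construct.Closure.ReflexiveTransitive
  using (Star; ε; _◅_; _◅◅_; reverse; gmap)
open import Relation.Binary.Core using (Rel)
open import Relation.Binary.Definitions using (tri<; tri≈; tri>)
open import Relation.Binary.PropositionalEquality
  using (_≡_; _≢_; refl; sym; trans; cong; subst; ≢-sym; setoid)
open import Relation.Nullary using (¬_; Dec; yes; no; does; contradiction)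
open import Relation.Nullary.Decidable using (_×-dec_; ¬?; decidable-stable)
open import Relation.Unary using (Pred; Decidable)

-- Lists without repetition and linked lists

lookup-injective : ∀ {A : Set} {xs : List A} → Unique xs →
  ∀ {i j} → lookup xs i ≡ lookup xs j → i ≡ j
lookup-injective (_ ∷ _) {zero}  {zero}  _  = refl
lookup-injective (x∉ ∷ _) {zero} {suc j} eq = contradiction eq (All.lookup x∉ (∈-lookup j))
lookup-injective (x∉ ∷ _) {suc i} {zero} eq = contradiction (sym eq) (All.lookup x∉ (∈-lookup i))
lookup-injective (_ ∷ u) {suc i} {suc j} eq = cong suc (lookup-injective u eq)

Unique-resp-↭ : ∀ {A : Set} {xs ys : List A} → xs ↭ ys → Unique xs → Unique ys
Unique-resp-↭ {A} p = Permutation.Unique-resp-↭ (setoid A) (↭⇒↭ₛ p)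

-- Pigeonhole: sending each position of `xs` to the position of its entry in `ys` is injective.
Unique-⊆⇒length≤ : ∀ {A : Set} {xs ys : List A} → Unique xs →
  (∀ {x} → x ∈ₗ xs → x ∈ₗ ys) → length xs ≤ length ys
Unique-⊆⇒length≤ {A} {xs} {ys} u xs⊆ys = injective⇒≤ {f = λ i → index (xs⊆ys (∈-lookup i))}
  (λ eq → lookup-injective u
    (index-injective (setoid A) (xs⊆ys (∈-lookup _)) (xs⊆ys (∈-lookup _)) eq))

module _ {A : Set} {R : Rel A 0ℓ} where

  linked-++⁻ : ∀ xs {v ys} → Linked R (xs ++ v ∷ ys) → Linked R (xs ++ [ v ]) × Linked R (v ∷ ys)
  linked-++⁻ []           l       = [-] , l
  linked-++⁻ (x ∷ [])     (r ∷ l) = (r ∷ [-]) , l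
  linked-++⁻ (x ∷ y ∷ xs) (r ∷ l) with l₁ , l₂ ← linked-++⁻ (y ∷ xs) l = (r ∷ l₁) , l₂

  linked-++⁺ : ∀ xs {v ys} → Linked R (xs ++ [ v ]) → Linked R (v ∷ ys) → Linked R (xs ++ v ∷ ys)
  linked-++⁺ []           _        l = l
  linked-++⁺ (x ∷ [])     (r ∷ _)  l = r ∷ l
  linked-++⁺ (x ∷ y ∷ xs) (r ∷ l′) l = r ∷ linked-++⁺ (y ∷ xs) l′ l

  linked-tabulate⁺ : ∀ {k} (f : Fin (suc k) → A) {y} →
    (∀ i → R (f (inject₁ i)) (f (suc i))) → R (f (fromℕ k)) y →
    Linked R (tabulate f ++ [ y ])
  linked-tabulate⁺ {zero}  f step final = final ∷ [-]
  linked-tabulate⁺ {suc k} f step final = step zero ∷ linked-tabulate⁺ (f ∘ suc) (step ∘ suc) final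

  linked-lookup : ∀ xs {y} → Linked R (xs ++ [ y ]) →
    ∀ {i j} → toℕ j ≡ suc (toℕ i) → R (lookup xs i) (lookup xs j)
  linked-lookup (x ∷ x′ ∷ xs) (r ∷ l) {zero}  {suc zero} refl = r
  linked-lookup (x ∷ x′ ∷ xs) (r ∷ l) {suc i} {suc j}    eq   =
    linked-lookup (x′ ∷ xs) l (suc-injective eq)

  linked-lookup-last : ∀ xs {y} → Linked R (xs ++ [ y ]) →
    ∀ {i} → suc (toℕ i) ≡ length xs → R (lookup xs i) y
  linked-lookup-last (x ∷ [])      (r ∷ _) {zero}  _  = r
  linked-lookup-last (x ∷ x′ ∷ xs) (_ ∷ l) {suc i} eq =
    linked-lookup-last (x′ ∷ xs) l (suc-injective eq)

-- The scan stops at the first entry failing `P`, whose predecessor still satisfies it. On a cycle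
-- this finds an edge leaving a vertex set.
exit-split : ∀ {A : Set} {P : A → Set} → Decidable P → ∀ {x} xs → P x → ¬ All P xs →
  ∃[ us ] ∃[ a ] ∃[ b ] ∃[ ts ] x ∷ xs ≡ us ++ a ∷ b ∷ ts × P a × ¬ P b
exit-split P? []       px ¬all = contradiction [] ¬all
exit-split P? {x} (y ∷ ys) px ¬all with P? y
... | no ¬py = [] , x , y , ys , refl , px , ¬py
... | yes py with us , a , b , ts , eq , pa , ¬pb ← exit-split P? ys py (λ all → ¬all (py ∷ all))
  = x ∷ us , a , b , ts , cong (x ∷_) eq , pa , ¬pb

-- Subsets cut out by decidable predicates

module _ {n : ℕ} {P : Pred (Fin n) 0ℓ} (P? : Decidable P) where

  comprehension : Subset n
  comprehension = Vec.tabulate (does ∘ P?)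

  ∈-comprehension⁺ : ∀ {x} → P x → x ∈ comprehension
  ∈-comprehension⁺ {x} px with P? x in eq
  ... | yes _  = lookup⇒[]= x _ (trans (lookup∘tabulate (does ∘ P?) x) (cong does eq))
  ... | no ¬px = contradiction px ¬px

  ∈-comprehension⁻ : ∀ {x} → x ∈ comprehension → P x
  ∈-comprehension⁻ {x} x∈ with P? x in eq
  ... | yes px = px
  ... | no _ with () ← trans (sym (trans (lookup∘tabulate (does ∘ P?) x) (cong does eq)))
                             ([]=⇒lookup x∈)

module _ {n : ℕ} (G : Graph n) where

  private
    V = Fin n

  open DecMembership (_≟_ {n}) using () renaming (_∈?_ to _∈ₗ?_)

  infix 4 _~_ _#_ _~?_

  _~_ _#_ : V → V → Set
  _~_ = Adj G
  x # y = ¬ x ~ y × x ≢ y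

  _~?_ : ∀ x y → Dec (x ~ y)
  _~?_ = Graph.adj? G

  ~-sym : ∀ {x y} → x ~ y → y ~ x
  ~-sym = Graph.sym G

  ~⇒≢ : ∀ {x y} → x ~ y → x ≢ y
  ~⇒≢ x~y x≡y = Graph.irrefl G x≡y x~y

  -- Induced copies

  Matches : Bool → V → V → Set
  Matches true  = _~_
  Matches false = _#_

  -- Only pairs of increasing indices are recorded, row by row; symmetry and irreflexivity settle
  -- the others.
  Table : ∀ m → (Fin m → Fin m → Bool) → (Fin m → V) → Set
  Table zero    h f = ⊤
  Table (suc m) h f = (∀ j → Matches (h zero (suc j)) (f zero) (f (suc j))) ×
                      Table m (λ i j → h (suc i) (suc j)) (f ∘ suc)

  table-lookup : ∀ m {h f} → Table m h f → ∀ i j → toℕ i < toℕ j → Matches (h i j) (f i) (f j)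
  table-lookup (suc m) (row , _)  zero    (suc j) _         = row j
  table-lookup (suc m) (_ , rest) (suc i) (suc j) (s≤s i<j) = table-lookup m rest i j i<j

  module _ {m} (H : Graph m) where

    -- Every table entry, `_~_` or `_#_`, entails distinct vertices, so the table gives injectivity
    -- as well.
    induced-copy : (f : Fin m → V) → Table m (λ i j → does (Graph.adj? H i j)) f → InducedCopy H G
    induced-copy f table = record { embed = f ; injective = injective ; induced = induced }
      where
      below : ∀ {i j} → toℕ i < toℕ j → (Adj H i j ⇔ f i ~ f j) × f i ≢ f j
      below {i} {j} i<j with Graph.adj? H i j | table-lookup m table i j i<j
      ... | yes h | fi~fj = mk⇔ (λ _ → fi~fj) (λ _ → h) , ~⇒≢ fi~fj
      ... | no ¬h | fi≁fj , fi≢fj =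
        mk⇔ (λ h → contradiction h ¬h) (λ e → contradiction e fi≁fj) , fi≢fj
      injective : ∀ {i j} → f i ≡ f j → i ≡ j
      injective {i} {j} eq with <-cmp i j
      ... | tri< i<j _ _ = contradiction eq (proj₂ (below i<j))
      ... | tri≈ _ i≡j _ = i≡j
      ... | tri> _ _ j<i = contradiction (sym eq) (proj₂ (below j<i))
      induced : ∀ i j → Adj H i j ⇔ f i ~ f j
      induced i j with <-cmp i j
      ... | tri< i<j _ _  = proj₁ (below i<j)
      ... | tri≈ _ refl _ = mk⇔ (λ h → contradiction h (Graph.irrefl H refl))
                                (λ e → contradiction refl (~⇒≢ e))
      ... | tri> _ _ j<i  = mk⇔ (~-sym ∘ Equivalence.to (proj₁ (below j<i)) ∘ Graph.sym H)
                                (Graph.sym H ∘ Equivalence.from (proj₁ (below j<i)) ∘ ~-sym)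

  -- Cycles as lists

  -- Repeating the first vertex at the end turns a cycle into a closed walk that can be cut and
  -- glued as a linked list. Distinctness and length are tracked separately.
  Circular : List V → Set
  Circular []       = ⊤
  Circular (x ∷ xs) = Linked _~_ (x ∷ xs ++ [ x ])

  circular-adjacent : ∀ xs → Circular xs → ∀ i j → Next {length xs} i j → lookup xs i ~ lookup xs j
  circular-adjacent xs@(_ ∷ _) c i j    (inj₁ eq)       = linked-lookup xs c eq
  circular-adjacent xs@(_ ∷ _) c i zero (inj₂ (eq , _)) = linked-lookup-last xs c eq

  circular⇒cycle : ∀ xs → 3 ≤ length xs → Unique xs → Circular xs → Cycle G
  circular⇒cycle xs 3≤ u c = record
    { length    = length xs
    ; length≥3  = 3≤
    ; vertex    = lookup xs
    ; injective = lookup-injective u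
    ; adjacent  = circular-adjacent xs c
    }

  vertices : Cycle G → List V
  vertices C = tabulate (Cycle.vertex C)

  vertices-length : ∀ C → 3 ≤ length (vertices C)
  vertices-length C =
    ≤-trans (Cycle.length≥3 C) (≤-reflexive (sym (length-tabulate (Cycle.vertex C))))

  vertices-unique : ∀ C → Unique (vertices C)
  vertices-unique C = tabulate⁺ (Cycle.injective C)

  vertices-circular : ∀ C → Circular (vertices C)
  vertices-circular record { length = suc k ; vertex = f ; adjacent = adj } =
    linked-tabulate⁺ f
      (λ i → adj _ _ (inj₁ (cong suc (sym (toℕ-inject₁ i)))))
      (adj _ _ (inj₂ (cong suc (toℕ-fromℕ k) , refl)))

  ∈-vertices : ∀ C {v} → v ∈ᶜ C ⇔ v ∈ₗ vertices C
  ∈-vertices C = mk⇔ (λ { (i , refl) → ∈-tabulate⁺ i })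
                     (λ v∈ → let i , eq = ∈-tabulate⁻ v∈ in i , sym eq)

  -- The closed walk is cut at `v`, and the two pieces are glued in the other order at the old
  -- starting vertex.
  rotate : ∀ xs v ys → Circular (xs ++ v ∷ ys) → Circular (v ∷ ys ++ xs)
  rotate []       v ys c rewrite ++-identityʳ ys = c
  rotate (x ∷ xs) v ys c
    rewrite ++-assoc xs (v ∷ ys) [ x ] | ++-assoc ys (x ∷ xs) [ v ]
    with l₁ , l₂ ← linked-++⁻ (x ∷ xs) c = linked-++⁺ (v ∷ ys) l₂ l₁

  rotate-to : ∀ {v xs} → Circular xs → v ∈ₗ xs → ∃[ ys ] Circular (v ∷ ys) × v ∷ ys ↭ xs
  rotate-to {v} c v∈ with as , bs , refl ← ∈-∃++ v∈ =
    bs ++ as , rotate as v bs c , ++-comm (v ∷ bs) as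

  -- The closing edge from `a` back to `b` is replaced by the detour through `h`.
  insert-last : ∀ {a b h} ms → h ~ a → h ~ b →
    Circular (b ∷ ms ++ [ a ]) → Circular (h ∷ b ∷ ms ++ [ a ])
  insert-last {a} {b} {h} ms h~a h~b c
    rewrite ++-assoc ms [ a ] [ b ] | ++-assoc ms [ a ] [ h ]
    with l₁ , _ ← linked-++⁻ (b ∷ ms) c = h~b ∷ linked-++⁺ (b ∷ ms) l₁ (~-sym h~a ∷ [-])

  delete-first : ∀ {v w u} us → (v ~ w → v ~ u → u ~ w) →
    Circular (v ∷ w ∷ us ++ [ u ]) → Circular (w ∷ us ++ [ u ])
  delete-first {v} {w} {u} us u~w (v~w ∷ l)
    rewrite ++-assoc us [ u ] [ v ] | ++-assoc us [ u ] [ w ]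
    with l₁ , u~v ∷ _ ← linked-++⁻ (w ∷ us) l =
      linked-++⁺ (w ∷ us) l₁ (u~w v~w (~-sym u~v) ∷ [-])

  -- The neighbours of `v` on the cycle are the first and last entries of `ws`. Length and
  -- uniqueness make them distinct, hence adjacent, and their edge closes up `ws`.
  delete-simplicial : ∀ {v ws} → 3 ≤ length ws → Unique ws →
    (∀ {a b} → a ∈ₗ ws → b ∈ₗ ws → v ~ a → v ~ b → a ≢ b → a ~ b) →
    Circular (v ∷ ws) → Circular ws
  delete-simplicial {ws = w ∷ ws} 3≤ u simp c with initLast ws
  delete-simplicial {ws = w ∷ .[]} (s≤s ()) u simp c | []
  delete-simplicial {ws = w ∷ .(us ++ [ x ])} 3≤ u simp c | us ∷ʳ′ x =
    delete-first us (λ v~w v~x → simp (there x∈) (here refl) v~x v~w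
      (λ { refl → Unique[x∷xs]⇒x∉xs u x∈ })) c
    where
    x∈ : x ∈ₗ us ++ [ x ]
    x∈ = ∈-insert us

  -- The rotation puts an edge leaving `A` in closing position, where `insert-last` can use it.
  exit-edge : ∀ {xs} (A : Subset n) → Circular xs → (∃[ a ] a ∈ₗ xs × a ∈ A) → ¬ All (_∈ A) xs →
    ∃[ a ] ∃[ b ] ∃[ ms ] Circular (b ∷ ms ++ [ a ]) × b ∷ ms ++ [ a ] ↭ xs × a ∈ A × b ∉ A × a ~ b
  exit-edge A c (x , x∈xs , x∈A) ¬all
    with ys , c′ , ys↭ ← rotate-to c x∈xs
    with exit-split (_∈? A) ys x∈A (λ all → ¬all (All-resp-↭ ys↭ (x∈A ∷ all)))
  ... | us , a , b , ts , eq , a∈A , b∉A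
    = a , b , ts ++ us
    , subst Circular assoc₁ (rotate (us ++ [ a ]) b ts (subst Circular assoc₂ c′))
    , ↭-trans (↭-reflexive (sym assoc₁))
        (↭-trans (++-comm (b ∷ ts) (us ++ [ a ])) (↭-trans (↭-reflexive (sym assoc₂)) ys↭))
    , a∈A , b∉A , a~b
    where
    assoc₁ : b ∷ ts ++ us ++ [ a ] ≡ b ∷ (ts ++ us) ++ [ a ]
    assoc₁ = cong (b ∷_) (sym (++-assoc ts us [ a ]))
    assoc₂ : x ∷ ys ≡ (us ++ [ a ]) ++ b ∷ ts
    assoc₂ = trans eq (sym (++-assoc us [ a ] (b ∷ ts)))
    a~b : a ~ b
    a~b with _ , a~b ∷ _ ← linked-++⁻ us (subst (Linked _~_)
          (trans (cong (_++ [ x ]) eq) (++-assoc us (a ∷ b ∷ ts) [ x ])) c′) = a~b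

  record Extension (xs : List V) : Set where
    field
      ys       : List V
      new      : V
      circular : Circular ys
      unique   : Unique ys
      new∉     : new ∉ₗ xs
      covers   : ∀ u → u ∈ₗ ys ⇔ (u ∈ₗ xs ⊎ u ≡ new)

  extension-by-↭ : ∀ {v xs ys} → v ∉ₗ xs → Unique xs → Circular (v ∷ ys) → ys ↭ xs → Extension xs
  extension-by-↭ {v} {xs} {ys} v∉ u c ys↭ = record
    { ys = v ∷ ys ; new = v ; circular = c
    ; unique = All.tabulate (λ { y∈ refl → v∉ (∈-resp-↭ ys↭ y∈) }) ∷ Unique-resp-↭ (↭-sym ys↭) u
    ; new∉ = v∉
    ; covers = λ u → mk⇔
        (λ { (here refl) → inj₂ refl ; (there u∈) → inj₁ (∈-resp-↭ ys↭ u∈) })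
        (λ { (inj₁ u∈) → there (∈-resp-↭ (↭-sym ys↭) u∈) ; (inj₂ refl) → here refl })
    }

  -- Chordless paths

  -- Chordless v xs: the list xs followed by v is an induced path.
  data Chordless (v : V) : List V → Set where
    stop : ∀ {x} → x ~ v → Chordless v [ x ]
    step : ∀ {x y ys} → x ~ y → x # v → All (x #_) ys → Chordless v (y ∷ ys) →
           Chordless v (x ∷ y ∷ ys)

  chordless⇒linked : ∀ {v xs} → Chordless v xs → Linked _~_ (xs ++ [ v ])
  chordless⇒linked (stop x~v)       = x~v ∷ [-]
  chordless⇒linked (step x~y _ _ p) = x~y ∷ chordless⇒linked p

  chordless⇒unique : ∀ {v xs} → Chordless v xs → Unique xs
  chordless⇒unique (stop _)          = [] ∷ []
  chordless⇒unique (step x~y _ x# p) = (~⇒≢ x~y ∷ All.map proj₂ x#) ∷ chordless⇒unique p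

  chordless⇒end∉ : ∀ {v xs} → Chordless v xs → All (v ≢_) xs
  chordless⇒end∉ (stop x~v)             = (~⇒≢ (~-sym x~v)) ∷ []
  chordless⇒end∉ (step _ (_ , x≢v) _ p) = ≢-sym x≢v ∷ chordless⇒end∉ p

  first-edge : ∀ {x y ys} → All (x #_) ys → ∀ j → x ~ lookup (y ∷ ys) j → toℕ j ≡ 0
  first-edge x# zero    _   = refl
  first-edge x# (suc j) x~ = contradiction x~ (proj₁ (All.lookup x# (∈-lookup j)))

  inner-edge : ∀ {v xs} → Chordless v xs → ∀ i j → lookup xs i ~ lookup xs j →
    toℕ j ≡ suc (toℕ i) ⊎ toℕ i ≡ suc (toℕ j)
  inner-edge {xs = _ ∷ _} p   zero    zero    e = contradiction refl (~⇒≢ e)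
  inner-edge (step _ _ x# p)  zero    (suc j) e = inj₁ (cong suc (first-edge x# j e))
  inner-edge (step _ _ x# p)  (suc i) zero    e = inj₂ (cong suc (first-edge x# i (~-sym e)))
  inner-edge (step _ _ _ p)   (suc i) (suc j) e =
    [ inj₁ ∘ cong suc , inj₂ ∘ cong suc ]′ (inner-edge p i j e)

  last-edge : ∀ {v xs} → Chordless v xs → ∀ i → lookup xs i ~ v → suc (toℕ i) ≡ length xs
  last-edge (stop _)                zero    _ = refl
  last-edge (step _ (x≁v , _) _ _)  zero    e = contradiction e x≁v
  last-edge (step _ _ _ p)          (suc i) e = cong suc (last-edge p i e)

  -- The vertices `v`, `u`, `x`, `y`, ... form a cycle of length at least 4. It has no chord, as the
  -- path is induced and `u` sees only its two ends.
  no-long-chordless : Chordal G → ∀ {u v x y ys} → v ~ u → u ~ x → All (u #_) (y ∷ ys) →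
    ¬ Chordless v (x ∷ y ∷ ys)
  no-long-chordless chordal {u} {v} {x} {y} {ys} v~u u~x u# p =
    chordal (circular⇒cycle cycle (s≤s (s≤s (s≤s z≤n))) unique (v~u ∷ u~x ∷ chordless⇒linked p))
      (s≤s (s≤s (s≤s (s≤s z≤n)))) induced
    where
    cycle : List V
    cycle = v ∷ u ∷ x ∷ y ∷ ys
    unique : Unique cycle
    unique = (~⇒≢ v~u ∷ chordless⇒end∉ p) ∷ (~⇒≢ u~x ∷ All.map proj₂ u#) ∷ chordless⇒unique p
    induced : ∀ i j → lookup cycle i ~ lookup cycle j → Next i j ⊎ Next j i
    induced zero          zero          e = contradiction refl (~⇒≢ e)
    induced zero          (suc zero)    e = inj₁ (inj₁ refl)
    -- The only neighbour of `v` on the path is its last entry; this is the wrap-around case of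
    -- `Next`.
    induced zero          (suc (suc j)) e =
      inj₂ (inj₂ (cong (2 +_) (last-edge p j (~-sym e)) , refl))
    induced (suc zero)    zero          e = inj₂ (inj₁ refl)
    induced (suc zero)    (suc zero)    e = contradiction refl (~⇒≢ e)
    induced (suc zero)    (suc (suc j)) e = inj₁ (inj₁ (cong (2 +_) (first-edge u# j e)))
    induced (suc (suc i)) zero          e = inj₁ (inj₂ (cong (2 +_) (last-edge p i e) , refl))
    induced (suc (suc i)) (suc zero)    e = inj₂ (inj₁ (cong (2 +_) (first-edge u# i (~-sym e))))
    induced (suc (suc i)) (suc (suc j)) e =
      [ inj₁ ∘ inj₁ ∘ cong (2 +_) , inj₂ ∘ inj₁ ∘ cong (2 +_) ]′ (inner-edge p i j e)

  -- The path is cut at the last vertex equal or adjacent to `u`, if there is one.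
  last-near : ∀ {P : V → Set} u {v xs} → Chordless v xs → All P xs →
    All (u #_) xs ⊎
    ∃[ z ] ∃[ zs ] Chordless v (z ∷ zs) × All P (z ∷ zs) × (u ~ z ⊎ u ≡ z) × All (u #_) zs
  last-near u {xs = x ∷ _} (stop x~v) Pxs with u ~? x | u ≟ x
  ... | yes u~x | _       = inj₂ (_ , _ , stop x~v , Pxs , inj₁ u~x , [])
  ... | no _    | yes u≡x = inj₂ (_ , _ , stop x~v , Pxs , inj₂ u≡x , [])
  ... | no u≁x  | no u≢x  = inj₁ ((u≁x , u≢x) ∷ [])
  last-near u {xs = x ∷ _} p@(step _ _ _ q) Pxs@(_ ∷ Pys) with last-near u q Pys
  ... | inj₂ found = inj₂ found
  ... | inj₁ u# with u ~? x | u ≟ x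
  ... | yes u~x | _       = inj₂ (_ , _ , p , Pxs , inj₁ u~x , u#)
  ... | no _    | yes u≡x = inj₂ (_ , _ , p , Pxs , inj₂ u≡x , u#)
  ... | no u≁x  | no u≢x  = inj₁ ((u≁x , u≢x) ∷ u#)

  -- Jumping from `x` to its last neighbour on the path avoids chords. If `x` sees `v`, it alone
  -- suffices; if the last near vertex is `x` itself, the path is cut there.
  extend-chordless : ∀ {P : V → Set} {x y v ys} → P x → x ≢ v → x ~ y →
    Chordless v (y ∷ ys) → All P (y ∷ ys) → ∃[ zs ] Chordless v (x ∷ zs) × All P (x ∷ zs)
  extend-chordless {x = x} {v = v} Px x≢v x~y p Pys with x ~? v | last-near x p Pys
  ... | yes x~v | _ = [] , stop x~v , Px ∷ []
  ... | no _    | inj₁ ((x≁y , _) ∷ _) = contradiction x~y x≁y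
  ... | no x≁v  | inj₂ (z , zs , q , Pzs , inj₁ x~z , x#) =
    z ∷ zs , step x~z (x≁v , x≢v) x# q , Px ∷ Pzs
  ... | no x≁v  | inj₂ (z , zs , q , Pzs , inj₂ refl , _) = zs , q , Pzs

  -- Connected sets and their boundaries

  Within : Subset n → Rel V 0ℓ
  Within E a b = a ∈ E × b ∈ E × a ~ b

  Connected : Subset n → Set
  Connected E = ∀ {a b} → a ∈ E → b ∈ E → Star (Within E) a b

  Touches : V → Subset n → Set
  Touches v E = ∃[ e ] e ∈ E × v ~ e

  touches? : ∀ v E → Dec (Touches v E)
  touches? v E = any? λ e → e ∈? E ×-dec v ~? e

  walk⇒chordless : ∀ {E a b v} → v ∉ E → a ∈ E → Star (Within E) a b → b ~ v →
    ∃[ zs ] Chordless v (a ∷ zs) × All (_∈ E) (a ∷ zs)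
  walk⇒chordless v∉E a∈E ε a~v = [] , stop a~v , a∈E ∷ []
  walk⇒chordless v∉E a∈E ((_ , c∈E , a~c) ◅ walk) b~v
    with zs , p , zs⊆E ← walk⇒chordless v∉E c∈E walk b~v
    = extend-chordless a∈E (λ { refl → v∉E a∈E }) a~c p zs⊆E

  -- A walk through `E` is made chordless and then cut at the last neighbour of `u`, so that the
  -- only possible chord of the path from `u` to `v` is the edge between these ends.
  chordless-through : ∀ {E u v} → Connected E → u ∉ E → v ∉ E → Touches u E → Touches v E →
    ∃[ z ] ∃[ zs ] Chordless v (z ∷ zs) × All (_∈ E) (z ∷ zs) × u ~ z × All (u #_) zs
  chordless-through {u = u} conn u∉E v∉E (a , a∈E , u~a) (b , b∈E , v~b)
    with zs , p , ⊆E ← walk⇒chordless v∉E a∈E (conn a∈E b∈E) (~-sym v~b)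
    with last-near u p ⊆E
  ... | inj₁ ((u≁a , _) ∷ _) = contradiction u~a u≁a
  ... | inj₂ (_ , _ , _ , z∈E ∷ _ , inj₂ refl , _) = contradiction z∈E u∉E
  ... | inj₂ (z , zs , q , ⊆E′ , inj₁ u~z , u#) = z , zs , q , ⊆E′ , u~z , u#

  -- A chordless path from `u` to `v` with two or more inner vertices would be closed by the edge
  -- `u ~ v` to a long induced cycle.
  common-neighbour : Chordal G → ∀ {E u v} → Connected E → u ∉ E → v ∉ E →
    Touches u E → Touches v E → u ~ v → ∃[ x ] x ∈ E × u ~ x × v ~ x
  common-neighbour chordal conn u∉E v∉E tu tv u~v with chordless-through conn u∉E v∉E tu tv
  ... | z , [] , stop z~v , z∈E ∷ _ , u~z , _ = z , z∈E , u~z , ~-sym z~v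
  ... | z , _ ∷ _ , p , _ , u~z , u# = ⊥-elim (no-long-chordless chordal (~-sym u~v) u~z u# p)

  -- Otherwise `s` closes a chordless path from `a` to `b` through `E` to a long induced cycle.
  boundary-clique : Chordal G → ∀ {E s a b} → Connected E → s ∉ E → ¬ Touches s E →
    Touches a E → Touches b E → s ~ a → s ~ b → a ≢ b → a ~ b
  boundary-clique chordal {E} {s} {a} {b} conn s∉E ¬ts ta tb s~a s~b a≢b with a ~? b
  ... | yes a~b = a~b
  ... | no a≁b
    with z , zs , p , ⊆E , a~z , a# ← chordless-through conn
           (λ a∈E → ¬ts (a , a∈E , s~a)) (λ b∈E → ¬ts (b , b∈E , s~b)) ta tb
    = ⊥-elim (no-long-chordless chordal (~-sym s~b) s~a
        (All.map (λ {e} e∈E → (λ s~e → ¬ts (e , e∈E , s~e)) , λ { refl → s∉E e∈E }) ⊆E)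
        (step a~z (a≁b , a≢b) a# p))

  record Component (D : Subset n) (e : V) : Set where
    field
      set       : Subset n
      set⊆      : set ⊆ D
      root∈     : e ∈ set
      connected : Connected set
      closed    : ∀ {a b} → a ∈ set → b ∈ D → a ~ b → b ∈ set

  -- Unfolding the closure computation makes type checking of its users very slow.
  abstract
    component : ∀ D {e} → e ∈ D → Component D e
    component D {e} e∈D = grow ⁅ e ⁆ (⊃-wellFounded _) (x∈⁅x⁆ e)
      (λ a∈ → subst (_∈ D) (sym (x∈⁅y⁆⇒x≡y e a∈)) e∈D)
      (λ a∈ → subst (Star _ e) (sym (x∈⁅y⁆⇒x≡y e a∈)) ε)
      where
      grow : ∀ E → Acc _⊃_ E → e ∈ E → E ⊆ D → (∀ {a} → a ∈ E → Star (Within E) e a) → Component D e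
      grow E (acc rs) e∈E E⊆D reach
        with any? (λ b → b ∈? D ×-dec ¬? (b ∈? E) ×-dec touches? b E)
      ... | no none = record
        { set = E ; set⊆ = E⊆D ; root∈ = e∈E
        ; connected = λ a∈ b∈ →
            reverse (λ (a∈ , b∈ , a~b) → b∈ , a∈ , ~-sym a~b) (reach a∈) ◅◅ reach b∈
        ; closed = λ {a} {b} a∈ b∈D a~b → decidable-stable (b ∈? E)
            λ b∉E → none (b , b∈D , b∉E , a , a∈ , ~-sym a~b)
        }
      ... | yes (b , b∈D , b∉E , a , a∈E , b~a) =
        grow (E ∪ ⁅ b ⁆) (rs (old , b , new , b∉E)) (old e∈E)
          (λ x∈ → [ E⊆D , (λ x∈b → subst (_∈ D) (sym (x∈⁅y⁆⇒x≡y b x∈b)) b∈D) ]′ (x∈p∪q⁻ E ⁅ b ⁆ x∈))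
          (λ x∈ → [ lift , (λ x∈b → subst (Star _ e) (sym (x∈⁅y⁆⇒x≡y b x∈b))
                       (lift a∈E ◅◅ ((old a∈E , new , ~-sym b~a) ◅ ε))) ]′ (x∈p∪q⁻ E ⁅ b ⁆ x∈))
        where
        old : E ⊆ E ∪ ⁅ b ⁆
        old x∈ = x∈p∪q⁺ (inj₁ x∈)
        new : b ∈ E ∪ ⁅ b ⁆
        new = x∈p∪q⁺ (inj₂ (x∈⁅x⁆ b))
        lift : ∀ {x} → x ∈ E → Star (Within (E ∪ ⁅ b ⁆)) e x
        lift x∈ = gmap (λ z → z) (λ (c∈ , d∈ , c~d) → old c∈ , old d∈ , c~d) (reach x∈)

  walk-exit : ∀ {A E a b} → Star (Within A) a b → a ∈ E → b ∉ E →
    ∃[ c ] ∃[ d ] c ∈ E × d ∈ A × d ∉ E × d ~ c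
  walk-exit ε a∈E a∉E = contradiction a∈E a∉E
  walk-exit {E = E} (_◅_ {j = c} (a∈A , c∈A , a~c) walk) a∈E b∉E with c ∈? E
  ... | yes c∈E = walk-exit walk c∈E b∉E
  ... | no c∉E  = _ , c , a∈E , c∈A , c∉E , ~-sym a~c

  -- Sides of clique separators

  Clique : Subset n → Set
  Clique S = ∀ {a b} → a ∈ S → b ∈ S → a ≢ b → a ~ b

  SimplicialIn : Subset n → V → Set
  SimplicialIn U d = ∀ {a b} → a ∈ U → b ∈ U → d ~ a → d ~ b → a ≢ b → a ~ b

  -- A full component `E` of G[W] - S: every vertex of `S` has a neighbour in it.
  record Side (W S E : Subset n) : Set where
    field
      {root}    : V
      root∈     : root ∈ E
      inside    : E ⊆ W
      S⊆W       : S ⊆ W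
      apart     : ∀ {a} → a ∈ S → a ∉ E
      connected : Connected E
      closed    : ∀ {a b} → a ∈ E → b ∈ W → a ~ b → b ∈ E ⊎ b ∈ S
      touching  : ∀ {a} → a ∈ S → Touches a E

  -- By `closed`, a vertex of `E` has all its neighbours in `W` already in `E ∪ S`.
  simplicial-lift : ∀ {W S E d} → Side W S E → d ∈ E ∪ S → d ∉ S → SimplicialIn (E ∪ S) d →
    d ∈ E × SimplicialIn W d
  simplicial-lift {W} {S} {E} {d} side d∈ d∉S simp =
    d∈E , λ a∈ b∈ d~a d~b → simp (near a∈ d~a) (near b∈ d~b) d~a d~b
    where
    d∈E : d ∈ E
    d∈E = [ (λ x → x) , (λ d∈S → contradiction d∈S d∉S) ]′ (x∈p∪q⁻ E S d∈)
    near : ∀ {a} → a ∈ W → d ~ a → a ∈ E ∪ S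
    near a∈ d~a = x∈p∪q⁺ (Side.closed side d∈E a∈ d~a)

  module _ (chordal : Chordal G) where

    record FarSide (W : Subset n) (s f : V) : Set where
      field
        {S E}    : Subset n
        side     : Side W S E
        clique   : Clique S
        f∈E      : f ∈ E
        S-near   : ∀ {a} → a ∈ S → s ~ a
        E-far    : ∀ {a} → a ∈ E → s # a

    abstract
      -- Here `E` is the component of `f` in G[W] - N[s] and `S` is its boundary, a clique by
      -- `boundary-clique` because `s` sees all of `S` and nothing of `E`.
      far-side : ∀ W {s f} → f ∈ W → s # f → FarSide W s f
      far-side W {s} {f} f∈W s#f = record
        { side = record
          { root∈ = K.root∈ ; inside = proj₁ ∘ far ; S⊆W = proj₁ ∘ ∈-comprehension⁻ boundary?
          ; apart = λ a∈S → proj₁ (proj₂ (∈-comprehension⁻ boundary? a∈S))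
          ; connected = K.connected
          ; closed = closed
          ; touching = touching
          }
        ; clique = λ a∈S b∈S → boundary-clique chordal K.connected s∉E ¬touch
            (touching a∈S) (touching b∈S) (near a∈S) (near b∈S)
        ; f∈E = K.root∈ ; S-near = near ; E-far = proj₂ ∘ far
        }
        where
        far? : Decidable λ x → x ∈ W × s # x
        far? x = x ∈? W ×-dec (¬? (s ~? x) ×-dec ¬? (s ≟ x))
        D : Subset n
        D = comprehension far?
        f-component : Component D f
        f-component = component D (∈-comprehension⁺ far? (f∈W , s#f))
        module K = Component f-component
        far : ∀ {a} → a ∈ K.set → a ∈ W × s # a
        far a∈ = ∈-comprehension⁻ far? (K.set⊆ a∈)
        boundary? : Decidable λ x → x ∈ W × x ∉ K.set × Touches x K.set
        boundary? x = x ∈? W ×-dec (¬? (x ∈? K.set) ×-dec touches? x K.set)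
        touching : ∀ {a} → a ∈ comprehension boundary? → Touches a K.set
        touching a∈S = proj₂ (proj₂ (∈-comprehension⁻ boundary? a∈S))
        s∉E : s ∉ K.set
        s∉E s∈ = proj₂ (proj₂ (far s∈)) refl
        ¬touch : ¬ Touches s K.set
        ¬touch (e , e∈ , s~e) = proj₁ (proj₂ (far e∈)) s~e
        near : ∀ {a} → a ∈ comprehension boundary? → s ~ a
        near {a} a∈S with a∈W , a∉E , (e , e∈ , a~e) ← ∈-comprehension⁻ boundary? a∈S =
          -- A boundary vertex not adjacent to `s` would be far from `s`, and the component would
          -- have absorbed it.
          decidable-stable (s ~? a) λ s≁a → a∉E (K.closed e∈
            (∈-comprehension⁺ far? (a∈W , s≁a , λ { refl → ¬touch (e , e∈ , a~e) })) (~-sym a~e))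
        closed : ∀ {a b} → a ∈ K.set → b ∈ W → a ~ b → b ∈ K.set ⊎ b ∈ comprehension boundary?
        closed {a} {b} a∈ b∈ a~b with b ∈? K.set
        ... | yes b∈E = inj₁ b∈E
        ... | no b∉E  = inj₂ (∈-comprehension⁺ boundary? (b∈ , b∉E , a , a∈ , ~-sym a~b))

    -- Dirac's argument: simplicial vertices off a clique

    SimplicialOff : Subset n → Subset n → Set
    SimplicialOff U S = ∃[ d ] d ∈ U × d ∉ S × SimplicialIn U d

    -- Prescribing a clique to avoid makes the induction work: in a piece cut off by a clique
    -- separator, the vertex found lies off the separator and so stays simplicial in the whole.
    simplicial-off-clique : ∀ U → Acc _⊂_ U → ∀ {S e} → S ⊆ U → Clique S → e ∈ U → e ∉ S →
      SimplicialOff U S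
    -- If `s` misses some `f` outside `S`, recursion goes to the side of `f` far from `s`, together
    -- with its boundary. Otherwise `s` is adjacent to all other vertices of `U` and can be removed.
    simplicial-off-nonempty-clique : ∀ U → Acc _⊂_ U → ∀ {S s e} → S ⊆ U → Clique S → s ∈ S →
      e ∈ U → e ∉ S → SimplicialOff U S

    simplicial-off-clique U rec {S} {e} S⊆U clique e∈U e∉S with any? (_∈? S)
    ... | yes (s , s∈S) = simplicial-off-nonempty-clique U rec S⊆U clique s∈S e∈U e∉S
    ... | no empty with any? (λ f → f ∈? U ×-dec ¬? (f ≟ e))
    ... | no single = e , e∈U , e∉S ,
      λ {a} a∈U _ e~a → contradiction (a , a∈U , ≢-sym (~⇒≢ e~a)) single
    ... | yes (f , f∈U , f≢e)
      -- An empty `S` is replaced by the clique consisting of `e`.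
      with d , d∈U , _ , simp ← simplicial-off-nonempty-clique U rec {⁅ e ⁆} {e}
             (λ a∈ → subst (_∈ U) (sym (x∈⁅y⁆⇒x≡y e a∈)) e∈U)
             (λ a∈ b∈ a≢b → contradiction (trans (x∈⁅y⁆⇒x≡y e a∈) (sym (x∈⁅y⁆⇒x≡y e b∈))) a≢b)
             (x∈⁅x⁆ e) f∈U (f≢e ∘ x∈⁅y⁆⇒x≡y e)
      = d , d∈U , (λ d∈S → empty (d , d∈S)) , simp

    simplicial-off-nonempty-clique U (acc rs) {S} {s} {e} S⊆U clique s∈S e∈U e∉S
      with any? (λ f → f ∈? U ×-dec (¬? (f ∈? S) ×-dec ¬? (s ~? f)))
    ... | yes (f , f∈U , f∉S , s≁f) = off
      where
      s≢f : s ≢ f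
      s≢f refl = f∉S s∈S
      open FarSide (far-side U f∈U (s≁f , s≢f)) renaming (S to T; clique to T-clique)
      open Side side
      smaller : E ∪ T ⊂ U
      smaller = (λ a∈ → [ inside , S⊆W ]′ (x∈p∪q⁻ E T a∈)) , s , S⊆U s∈S ,
        λ s∈ → [ (λ s∈E → proj₂ (E-far s∈E) refl) , (λ s∈T → ~⇒≢ (S-near s∈T) refl) ]′
                 (x∈p∪q⁻ E T s∈)
      off : SimplicialOff U S
      off with d , d∈ , d∉T , simp ←
                 simplicial-off-clique (E ∪ T) (rs smaller) (λ a∈ → x∈p∪q⁺ (inj₂ a∈)) T-clique
                 (x∈p∪q⁺ (inj₁ f∈E)) (λ f∈T → apart f∈T f∈E)
          with d∈E , simp′ ← simplicial-lift side d∈ d∉T simp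
          = d , inside d∈E
            -- The clique `S` contains `s`, whereas `d` is far from `s`.
            , (λ d∈S → let s≁d , s≢d = E-far d∈E in s≁d (clique s∈S d∈S s≢d)) , simp′
    ... | no ¬far = off
      where
      minus? : ∀ D → Decidable λ x → x ∈ D × x ≢ s
      minus? D x = x ∈? D ×-dec ¬? (x ≟ s)
      minus : Subset n → Subset n
      minus D = comprehension (minus? D)
      dominated : ∀ {a} → a ∈ U → a ≢ s → s ~ a
      dominated {a} a∈U a≢s with a ∈? S
      ... | yes a∈S = clique s∈S a∈S (≢-sym a≢s)
      ... | no a∉S  = decidable-stable (s ~? a) λ s≁a → ¬far (a , a∈U , a∉S , s≁a)
      off : SimplicialOff U S
      off with d , d∈ , d∉ , simp ← simplicial-off-clique (minus U)
                 (rs (proj₁ ∘ ∈-comprehension⁻ (minus? U) , s , S⊆U s∈S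
                     , λ s∈ → proj₂ (∈-comprehension⁻ (minus? U) s∈) refl))
                 {minus S} {e}
                 (λ a∈ → let a∈S , a≢s = ∈-comprehension⁻ (minus? S) a∈
                         in ∈-comprehension⁺ (minus? U) (S⊆U a∈S , a≢s))
                 (λ a∈ b∈ → clique (proj₁ (∈-comprehension⁻ (minus? S) a∈))
                                   (proj₁ (∈-comprehension⁻ (minus? S) b∈)))
                 (∈-comprehension⁺ (minus? U) (e∈U , λ { refl → e∉S s∈S }))
                 (e∉S ∘ proj₁ ∘ ∈-comprehension⁻ (minus? S))
          with d∈U , d≢s ← ∈-comprehension⁻ (minus? U) d∈
          = d , d∈U , (λ d∈S → d∉ (∈-comprehension⁺ (minus? S) (d∈S , d≢s))) , simplicial
        where
        simplicial : SimplicialIn U d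
        simplicial {a} {b} a∈U b∈U d~a d~b a≢b with a ≟ s | b ≟ s
        ... | yes refl | _        = dominated b∈U (≢-sym a≢b)
        ... | no a≢s   | yes refl = ~-sym (dominated a∈U a≢s)
        ... | no a≢s   | no b≢s   = simp (∈-comprehension⁺ (minus? U) (a∈U , a≢s))
                                         (∈-comprehension⁺ (minus? U) (b∈U , b≢s)) d~a d~b a≢b

    simplicial-in-side : ∀ {W S E} → Side W S E → Clique S → ∃[ d ] d ∈ E × SimplicialIn W d
    simplicial-in-side {W} {S} {E} side clique
      with d , d∈ , d∉S , simp ←
             simplicial-off-clique (E ∪ S) (⊂-wellFounded _) (λ a∈ → x∈p∪q⁺ (inj₂ a∈)) clique
             (x∈p∪q⁺ (inj₁ (Side.root∈ side))) (λ r∈S → Side.apart side r∈S (Side.root∈ side))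
      = d , simplicial-lift side d∈ d∉S simp

    -- Pairs of separator vertices told apart by a side

    Splits : Subset n → V → V → Set
    Splits A s t = ∃[ a ] a ∈ A × a ~ s × ¬ a ~ t

    Separates : Subset n → V → V → Set
    Separates A s t = Splits A s t ⊎ Splits A t s

    splits? : ∀ A s t → Dec (Splits A s t)
    splits? A s t = any? λ a → a ∈? A ×-dec (a ~? s ×-dec ¬? (a ~? t))

    -- Transitivity of being unseparated, in contrapositive form: the separating vertex either sees
    -- `w` or misses it.
    separates-either : ∀ {A s t} w → Separates A s t → Separates A s w ⊎ Separates A w t
    separates-either w (inj₁ (a , a∈A , a~s , a≁t)) with a ~? w
    ... | yes a~w = inj₂ (inj₁ (a , a∈A , a~w , a≁t))
    ... | no a≁w  = inj₁ (inj₁ (a , a∈A , a~s , a≁w))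
    separates-either w (inj₂ (a , a∈A , a~t , a≁s)) with a ~? w
    ... | yes a~w = inj₁ (inj₂ (a , a∈A , a~w , a≁s))
    ... | no a≁w  = inj₂ (inj₂ (a , a∈A , a~t , a≁w))

    Uniform : Subset n → Subset n → Set
    Uniform A S = ∀ {a s t} → a ∈ A → s ∈ S → t ∈ S → a ~ s → a ~ t

    uniform-or-split : ∀ A S → Uniform A S ⊎ ∃[ s ] ∃[ t ] s ∈ S × t ∈ S × Splits A s t
    uniform-or-split A S with any? (λ s → any? (λ t → s ∈? S ×-dec (t ∈? S ×-dec splits? A s t)))
    ... | yes found = inj₂ found
    ... | no none   = inj₁ λ {a} {s} {t} a∈A s∈S t∈S a~s → decidable-stable (a ~? t)
      λ a≁t → none (s , t , s∈S , t∈S , a , a∈A , a~s , a≁t)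

    -- Being unseparated by A, or by B, is an equivalence relation on S; two
    -- equivalence relations that together relate every pair cannot both be proper.
    one-uniform : ∀ A B S →
      (∀ {s t} → s ∈ S → t ∈ S → Separates A s t → ¬ Separates B s t) → Uniform A S ⊎ Uniform B S
    one-uniform A B S exclusive with uniform-or-split A S | uniform-or-split B S
    ... | inj₁ uniA | _ = inj₁ uniA
    ... | inj₂ _ | inj₁ uniB = inj₂ uniB
    ... | inj₂ (s , t , s∈ , t∈ , splitA) | inj₂ (y , z , y∈ , z∈ , splitB) =
      ⊥-elim ([ (λ y|s → refute y∈ (swap y|s)) , refute z∈ ]′ (separates-either s (inj₁ splitB)))
      where
      refute : ∀ {w} → w ∈ S → ¬ Separates B s w
      refute {w} w∈ B-sw with separates-either w (inj₁ splitA) | separates-either t B-sw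
      ... | inj₁ A-sw | _         = exclusive s∈ w∈ A-sw B-sw
      ... | inj₂ _    | inj₁ B-st = exclusive s∈ t∈ (inj₁ splitA) B-st
      ... | inj₂ A-wt | inj₂ B-tw = exclusive w∈ t∈ A-wt (swap B-tw)

    -- Half of a forbidden graph: over an edge `s t`, the triangles `p s t` and `p′ p s`.
    record Wedge (A : Subset n) (s t : V) : Set where
      field
        {p p′} : V
        p∈A    : p ∈ A
        p′∈A   : p′ ∈ A
        p~s    : p ~ s
        p~t    : p ~ t
        p′~p   : p′ ~ p
        p′~s   : p′ ~ s
        p′≁t   : ¬ p′ ~ t

    -- Let `K.set` be the component of `a` among the vertices of `A` not adjacent to `t`. A walk in
    -- `A` to a neighbour of `t` leaves it at `p`; the vertex `p′` is found inside it.
    split⇒wedge : ∀ {W S A s t} → Side W S A → Clique S → s ∈ S → t ∈ S → Splits A s t → Wedge A s t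
    split⇒wedge {S = S} {A} {s} {t} side clique s∈S t∈S (a , a∈A , a~s , a≁t) =
      let a″ , a″∈A , t~a″ = Side.touching side t∈S
          c , p , c∈E , p∈A , p∉E , p~c =
            walk-exit (Side.connected side a∈A a″∈A) K.root∈ (λ a″∈E → proj₂ (far a″∈E) t~a″)
          -- If `t` missed `p`, closure would put `p` in `K.set`.
          t~p = decidable-stable (t ~? p) λ t≁p →
            p∉E (K.closed c∈E (∈-comprehension⁺ far? (p∈A , t≁p)) (~-sym p~c))
          s-touch = a , K.root∈ , ~-sym a~s
          p-touch = c , c∈E , p~c
          -- Both `s` and `p` touch `K.set` and are adjacent to `t`, which does not touch it.
          s~p = boundary-clique chordal K.connected (A∌ t∈S) ¬t-touch s-touch p-touch t~s t~p
                  (λ { refl → Side.apart side s∈S p∈A })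
          p′ , p′∈E , s~p′ , p~p′ =
            common-neighbour chordal K.connected (A∌ s∈S) p∉E s-touch p-touch s~p
          p′∈A , t≁p′ = far p′∈E
      in record
        { p∈A = p∈A ; p′∈A = p′∈A ; p~s = ~-sym s~p ; p~t = ~-sym t~p
        ; p′~p = ~-sym p~p′ ; p′~s = ~-sym s~p′ ; p′≁t = t≁p′ ∘ ~-sym }
      where
      far? : Decidable λ x → x ∈ A × ¬ t ~ x
      far? x = x ∈? A ×-dec ¬? (t ~? x)
      a-component : Component (comprehension far?) a
      a-component = component (comprehension far?) (∈-comprehension⁺ far? (a∈A , a≁t ∘ ~-sym))
      module K = Component a-component
      far : ∀ {x} → x ∈ K.set → x ∈ A × ¬ t ~ x
      far x∈ = ∈-comprehension⁻ far? (K.set⊆ x∈)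
      A∌ : ∀ {x} → x ∈ S → x ∉ K.set
      A∌ x∈S x∈E = Side.apart side x∈S (proj₁ (far x∈E))
      ¬t-touch : ¬ Touches t K.set
      ¬t-touch (e , e∈E , t~e) = proj₂ (far e∈E) t~e
      t~s : t ~ s
      t~s = clique t∈S s∈S λ { refl → a≁t a~s }

    -- Forbidden subgraphs across a clique separator

    module _ (no-fan : (4-fan -free) G) (no-Ā : (Ā -free) G)
             {W S A B} (sideA : Side W S A) (sideB : Side W S B) (disjoint : ∀ {a} → a ∈ A → a ∉ B)
             (clique : Clique S) where

      private
        across : ∀ {a b} → a ∈ A → b ∈ B → a # b
        across a∈A b∈B =
          (λ a~b → [ (λ b∈A → disjoint b∈A b∈B) , (λ b∈S → Side.apart sideB b∈S b∈B) ]′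
                     (Side.closed sideA a∈A (Side.inside sideB b∈B) a~b))
          , λ { refl → disjoint a∈A b∈B }

        ≢-side : ∀ {E a s} → Side W S E → a ∈ E → s ∈ S → a ≢ s
        ≢-side side a∈E s∈S refl = Side.apart side s∈S a∈E

      -- The path runs `P.p′`, `P.p`, `t`, `Q.p`, `Q.p′`, and `s` is the hub.
      wedges-same-apex : ∀ {s t} → s ∈ S → t ∈ S → Wedge A s t → Wedge B s t → ⊥
      wedges-same-apex {s} {t} s∈S t∈S P Q =
        no-fan (induced-copy 4-fan (Vec.lookup (P.p′ ∷ P.p ∷ t ∷ Q.p ∷ Q.p′ ∷ s ∷ []))
          ( (λ { 0F → P.p′~p ; 1F → P.p′≁t , ≢-side sideA P.p′∈A t∈S
               ; 2F → across P.p′∈A Q.p∈A ; 3F → across P.p′∈A Q.p′∈A ; 4F → P.p′~s })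
          , (λ { 0F → P.p~t ; 1F → across P.p∈A Q.p∈A ; 2F → across P.p∈A Q.p′∈A ; 3F → P.p~s })
          , (λ { 0F → ~-sym Q.p~t ; 1F → Q.p′≁t ∘ ~-sym , ≢-sym (≢-side sideB Q.p′∈A t∈S)
               ; 2F → clique t∈S s∈S λ { refl → P.p′≁t P.p′~s } })
          , (λ { 0F → ~-sym Q.p′~p ; 1F → Q.p~s })
          , (λ { 0F → Q.p′~s })
          , (λ ()) , tt ))
        where
        module P = Wedge P
        module Q = Wedge Q

      -- Here `s` and `t` play the roles of `z` and `z′`, since `P.p′` is attached at `s` and `Q.p′`
      -- at `t`.
      wedges-opposite-apexes : ∀ {s t} → s ∈ S → t ∈ S → Wedge A s t → Wedge B t s → ⊥
      wedges-opposite-apexes {s} {t} s∈S t∈S P Q =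
        no-Ā (induced-copy Ā (Vec.lookup (P.p′ ∷ P.p ∷ s ∷ t ∷ Q.p ∷ Q.p′ ∷ []))
          ( (λ { 0F → P.p′~p ; 1F → P.p′~s ; 2F → P.p′≁t , ≢-side sideA P.p′∈A t∈S
               ; 3F → across P.p′∈A Q.p∈A ; 4F → across P.p′∈A Q.p′∈A })
          , (λ { 0F → P.p~s ; 1F → P.p~t ; 2F → across P.p∈A Q.p∈A ; 3F → across P.p∈A Q.p′∈A })
          , (λ { 0F → clique s∈S t∈S λ { refl → P.p′≁t P.p′~s }
               ; 1F → ~-sym Q.p~t ; 2F → Q.p′≁t ∘ ~-sym , ≢-sym (≢-side sideB Q.p′∈A s∈S) })
          , (λ { 0F → ~-sym Q.p~s ; 1F → ~-sym Q.p′~s })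
          , (λ { 0F → ~-sym Q.p′~p })
          , (λ ()) , tt ))
        where
        module P = Wedge P
        module Q = Wedge Q

      uniform-side : Uniform A S ⊎ Uniform B S
      uniform-side = one-uniform A B S exclusive
        where
        wedgeA : ∀ {s t} → s ∈ S → t ∈ S → Splits A s t → Wedge A s t
        wedgeA = split⇒wedge sideA clique
        wedgeB : ∀ {s t} → s ∈ S → t ∈ S → Splits B s t → Wedge B s t
        wedgeB = split⇒wedge sideB clique
        exclusive : ∀ {s t} → s ∈ S → t ∈ S → Separates A s t → ¬ Separates B s t
        exclusive s∈ t∈ (inj₁ a) (inj₁ b) = wedges-same-apex s∈ t∈ (wedgeA s∈ t∈ a) (wedgeB s∈ t∈ b)
        exclusive s∈ t∈ (inj₁ a) (inj₂ b) =
          wedges-opposite-apexes s∈ t∈ (wedgeA s∈ t∈ a) (wedgeB t∈ s∈ b)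
        exclusive s∈ t∈ (inj₂ a) (inj₁ b) =
          wedges-opposite-apexes t∈ s∈ (wedgeA t∈ s∈ a) (wedgeB s∈ t∈ b)
        exclusive s∈ t∈ (inj₂ a) (inj₂ b) = wedges-same-apex t∈ s∈ (wedgeA t∈ s∈ a) (wedgeB t∈ s∈ b)

    -- Extending a cycle

    -- A cycle edge leaving `E` from `a` ends at some `b` in `S`. Uniformity makes `h` adjacent to
    -- `a`, the clique makes it adjacent to `b`, and `h` fits between them.
    inside-outside-or-extend : ∀ {W S E h xs} → Side W S E → Uniform E S → Clique S →
      h ∈ S → h ∉ₗ xs → Circular xs → Unique xs → All (_∈ W) xs →
      All (_∈ E) xs ⊎ All (_∉ E) xs ⊎ Extension xs
    inside-outside-or-extend {W} {S} {E} {h} {xs} side uniform clique h∈S h∉xs c u xs⊆W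
      with Any.any? (_∈? E) xs | All.all? (_∈? E) xs
    ... | no none  | _       = inj₂ (inj₁ (¬Any⇒All¬ xs none))
    ... | yes _    | yes all = inj₁ all
    ... | yes some | no ¬all
      with x , x∈xs , x∈E ← find some
      with a , b , ms , c′ , ↭xs , a∈E , b∉E , a~b ← exit-edge E c (x , x∈xs , x∈E) ¬all
      = inj₂ (inj₂ (extension-by-↭ h∉xs u (insert-last ms h~a h~b c′) ↭xs))
      where
      b∈xs : b ∈ₗ xs
      b∈xs = ∈-resp-↭ ↭xs (here refl)
      b∈S : b ∈ S
      b∈S = [ (λ b∈E → contradiction b∈E b∉E) , (λ b∈ → b∈) ]′
              (Side.closed side a∈E (All.lookup xs⊆W b∈xs) a~b)
      h~a : h ~ a
      h~a = ~-sym (uniform a∈E b∈S h∈S a~b)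
      h~b : h ~ b
      h~b = clique h∈S b∈S λ { refl → h∉xs b∈xs }

    SimplicialOutside : Subset n → List V → Set
    SimplicialOutside W xs = ∃[ d ] d ∈ W × d ∉ₗ xs × SimplicialIn W d

    -- Unless `h` can be inserted, the cycle avoids `A`, or lies in `A` and so avoids `B`; the
    -- avoided side contains a simplicial vertex.
    uniform-side⇒simplicial-outside : ∀ {W S A B h xs} → Side W S A → Side W S B →
      (∀ {a} → a ∈ A → a ∉ B) → Clique S → Uniform A S →
      h ∈ S → h ∉ₗ xs → Circular xs → Unique xs → All (_∈ W) xs →
      SimplicialOutside W xs ⊎ Extension xs
    uniform-side⇒simplicial-outside {xs = xs} sideA sideB disjoint clique uniform h∈S h∉xs c u xs⊆W
      with inside-outside-or-extend sideA uniform clique h∈S h∉xs c u xs⊆W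
    ... | inj₂ (inj₂ ext) = inj₂ ext
    ... | inj₂ (inj₁ xs∉A)
      with d , d∈A , simp ← simplicial-in-side sideA clique
      = inj₁ (d , Side.inside sideA d∈A , (λ d∈xs → All.lookup xs∉A d∈xs d∈A) , simp)
    ... | inj₁ xs⊆A
      with d , d∈B , simp ← simplicial-in-side sideB clique
      = inj₁ (d , Side.inside sideB d∈B , (λ d∈xs → disjoint (All.lookup xs⊆A d∈xs) d∈B) , simp)

    module _ (no-fan : (4-fan -free) G) (no-Ā : (Ā -free) G) where

      nonsimplicial⇒simplicial-outside : ∀ {W h x y xs} → h ∈ W → x ∈ W → y ∈ W →
        h ~ x → h ~ y → x # y → h ∉ₗ xs → Circular xs → Unique xs → All (_∈ W) xs →
        SimplicialOutside W xs ⊎ Extension xs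
      nonsimplicial⇒simplicial-outside {W} {h} {x} {y} {xs} h∈W x∈W y∈W h~x h~y x#y h∉xs c u xs⊆W
        = conclude (uniform-side no-fan no-Ā sideA side disjoint clique)
        where
        open FarSide (far-side W y∈W x#y) renaming (E to B; f∈E to y∈B; E-far to B-far)
        module B = Side side
        h∈S : h ∈ S
        -- As a neighbour of `y`, `h` lies in `B` or `S`; being adjacent to `x` rules out `B`.
        h∈S = [ (λ h∈B → contradiction (~-sym h~x) (proj₁ (B-far h∈B))) , (λ h∈ → h∈) ]′
                (B.closed y∈B h∈W (~-sym h~y))
        rest? : Decidable λ v → v ∈ W × v ∉ B × v ∉ S
        rest? v = v ∈? W ×-dec (¬? (v ∈? B) ×-dec ¬? (v ∈? S))
        x-component : Component (comprehension rest?) x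
        x-component = component (comprehension rest?) (∈-comprehension⁺ rest?
          (x∈W , (λ x∈B → proj₂ (B-far x∈B) refl) , λ x∈S → ~⇒≢ (S-near x∈S) refl))
        module A = Component x-component
        rest : ∀ {v} → v ∈ A.set → v ∈ W × v ∉ B × v ∉ S
        rest v∈ = ∈-comprehension⁻ rest? (A.set⊆ v∈)
        disjoint : ∀ {v} → v ∈ A.set → v ∉ B
        disjoint v∈ = proj₁ (proj₂ (rest v∈))
        A-closed : ∀ {a b} → a ∈ A.set → b ∈ W → a ~ b → b ∈ A.set ⊎ b ∈ S
        A-closed {a} {b} a∈ b∈W a~b with b ∈? S | b ∈? B
        ... | yes b∈S | _       = inj₂ b∈S
        ... | no b∉S  | no b∉B  = inj₁ (A.closed a∈ (∈-comprehension⁺ rest? (b∈W , b∉B , b∉S)) a~b)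
        ... | no _    | yes b∈B =
          let a∈W , a∉B , a∉S = rest a∈
          in ⊥-elim ([ a∉B , a∉S ]′ (B.closed b∈B a∈W (~-sym a~b)))
        sideA : Side W S A.set
        sideA = record
          { root∈ = A.root∈ ; inside = proj₁ ∘ rest ; S⊆W = B.S⊆W
          ; apart = λ v∈S v∈A → proj₂ (proj₂ (rest v∈A)) v∈S
          ; connected = A.connected ; closed = A-closed
          -- Every vertex of `S` is adjacent to `x` itself.
          ; touching = λ v∈S → x , A.root∈ , ~-sym (S-near v∈S)
          }
        conclude : Uniform A.set S ⊎ Uniform B S → SimplicialOutside W xs ⊎ Extension xs
        conclude (inj₁ uniform) =
          uniform-side⇒simplicial-outside sideA side disjoint clique uniform h∈S h∉xs c u xs⊆W
        conclude (inj₂ uniform) =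
          uniform-side⇒simplicial-outside side sideA (λ b∈B b∈A → disjoint b∈A b∈B) clique uniform
            h∈S h∉xs c u xs⊆W

      simplicial-outside : ∀ {W h xs} → h ∈ W → h ∉ₗ xs → Circular xs → Unique xs → All (_∈ W) xs →
        SimplicialOutside W xs ⊎ Extension xs
      simplicial-outside {W} {h} h∈W h∉xs c u xs⊆W
        with any? (λ x → any? (λ y → x ∈? W ×-dec (y ∈? W ×-dec (h ~? x ×-dec (h ~? y ×-dec
                   (¬? (x ~? y) ×-dec ¬? (x ≟ y)))))))
      ... | yes (x , y , x∈W , y∈W , h~x , h~y , x#y) =
        nonsimplicial⇒simplicial-outside h∈W x∈W y∈W h~x h~y x#y h∉xs c u xs⊆W
      -- Without nonadjacent neighbours in `W`, `h` itself is simplicial.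
      ... | no none = inj₁ (h , h∈W , h∉xs , λ {a} {b} a∈W b∈W h~a h~b a≢b →
        decidable-stable (a ~? b) λ a≁b → none (a , b , a∈W , b∈W , h~a , h~b , a≁b , a≢b))

      -- Induction on the length of the enclosing cycle: `xs` stays fixed while simplicial vertices
      -- outside it are deleted from `zs`.
      extend-within : ∀ {zs h xs} → Acc _<_ (length zs) → Circular zs → Unique zs →
        3 ≤ length xs → Circular xs → Unique xs → (∀ {v} → v ∈ₗ xs → v ∈ₗ zs) →
        h ∈ₗ zs → h ∉ₗ xs → Extension xs
      extend-within {zs} {h} {xs} (acc rs) czs uzs 3≤ c u xs⊆zs h∈zs h∉xs
        with simplicial-outside (∈-comprehension⁺ (_∈ₗ? zs) h∈zs) h∉xs c u
               (All.tabulate (∈-comprehension⁺ (_∈ₗ? zs) ∘ xs⊆zs))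
      ... | inj₂ ext = ext
      ... | inj₁ (v , v∈W , v∉xs , simp)
        with ws , cws , ws↭ ← rotate-to czs (∈-comprehension⁻ (_∈ₗ? zs) v∈W)
        with v∉ws ∷ uws ← Unique-resp-↭ (↭-sym ws↭) uzs
        with Any.any? (λ w → ¬? (w ∈ₗ? xs)) ws
      ... | yes some with h′ , h′∈ws , h′∉xs ← find some =
        extend-within (rs (≤-reflexive (↭-length ws↭)))
          -- The shortened list still contains all of `xs`, hence has at least three entries.
          (delete-simplicial (≤-trans 3≤ (Unique-⊆⇒length≤ u xs⊆ws)) uws
            (λ a∈ b∈ → simp (in-W a∈) (in-W b∈)) cws)
          uws 3≤ c u xs⊆ws h′∈ws h′∉xs
        where
        xs⊆ws : ∀ {a} → a ∈ₗ xs → a ∈ₗ ws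
        xs⊆ws a∈ with ∈-resp-↭ (↭-sym ws↭) (xs⊆zs a∈)
        ... | here refl = contradiction a∈ v∉xs
        ... | there a∈ws = a∈ws
        in-W : ∀ {a} → a ∈ₗ ws → a ∈ comprehension (_∈ₗ? zs)
        in-W a∈ = ∈-comprehension⁺ (_∈ₗ? zs) (∈-resp-↭ ws↭ (there a∈))
      -- Now `v` is the only vertex of `zs` outside `xs`, so the enclosing cycle is the extension.
      ... | no none = record
        { ys = v ∷ ws ; new = v ; circular = cws ; unique = v∉ws ∷ uws ; new∉ = v∉xs
        ; covers = λ a → mk⇔
            (λ { (here refl) → inj₂ refl
               ; (there a∈) → inj₁ (decidable-stable (a ∈ₗ? xs)
                   (All.lookup (¬Any⇒All¬ ws none) a∈)) })
            (λ { (inj₁ a∈) → ∈-resp-↭ (↭-sym ws↭) (xs⊆zs a∈) ; (inj₂ refl) → here refl })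
        }

  -- Return from lists to cycles, and conclusion

  extension⇒extendable : ∀ C → Extension (vertices C) → Extendable C
  extension⇒extendable C ext =
    circular⇒cycle ys 3≤ unique circular
    , new
    , new∉ ∘ Equivalence.to (∈-vertices C)
    , λ u → mk⇔
        (λ { (i , refl) → map₁ (Equivalence.from (∈-vertices C))
                               (Equivalence.to (covers _) (∈-lookup i)) })
        (λ u∈ → let u∈ys = Equivalence.from (covers u) (map₁ (Equivalence.to (∈-vertices C)) u∈)
                in index u∈ys , sym (lookup-index u∈ys))
    where
    open Extension ext
    3≤ : 3 ≤ length ys
    3≤ = ≤-trans (vertices-length C)
           (Unique-⊆⇒length≤ (vertices-unique C) (λ x∈ → Equivalence.from (covers _) (inj₁ x∈)))

theorem1p3 : ∀ (n : ℕ) (G : Graph n) →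
    Hamiltonian G → (4-fan -free) G → (Ā -free) G → Chordal G →
    CycleExtendable G
theorem1p3 n G (Z , ham) no-fan no-Ā chordal C ¬ham
  -- A finite search turns the negated universal statement into a concrete vertex missed by `C`.
  with any? (λ v → ¬? (any? (λ i → Cycle.vertex C i ≟ v)))
... | no none = contradiction
  (λ v → decidable-stable (any? (λ i → Cycle.vertex C i ≟ v)) (λ v∉ → none (v , v∉))) ¬ham
... | yes (h , h∉C) = extension⇒extendable G C
  (extend-within G chordal no-fan no-Ā (<-wellFounded _)
    (vertices-circular G Z) (vertices-unique G Z)
    (vertices-length G C) (vertices-circular G C) (vertices-unique G C)
    (λ {v} _ → Equivalence.to (∈-vertices G Z) (ham v))
    (Equivalence.to (∈-vertices G Z) (ham h))
    (h∉C ∘ Equivalence.from (∈-vertices G C)))
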